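{- For every bipartite graph $G$, $$a(G)-\alpha(G)\le 2+\mu(G)-2\sqrt{1+\mu(G)} .$$
   Context: All graphs are finite, undirected, without loops or multiple edges. For a graph $G$, $m(G)$ is its number of edges, $\alpha(G)$ is its independence number, and $\mu(G)$ is its matching number (maximum size of a set of edges no two of which share a vertex). If $d_1\le d_2\le\cdots\le d_n$ is the degree sequence of $G$, the annihilation number $a(G)$ is the largest integer $k\in\{0,\dots,n\}$ such that $\sum_{i=1}^k d_i\le m(G)$. -}

module Defs where

open import Level using (0ℓ)
open import Data.Fin as Fin using (Fin)
import Data.Fin.Properties as Fin
open import Data.Fin.Subset using (Subset; _∈_; ∣_∣; ∁; ⊥)
open import Data.Fin.Subset.Properties using (_∈?_; anySubset?; ∣p∣≤n; ∣⊥∣≡0; ∉⊥)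
open import Data.Integer using (ℤ; +_)
open import Data.List using (List; filter; length; lookup; map; allFin; cartesianProduct; take)
open import Data.List.Sort using (sort)
open import Data.Nat as ℕ using (ℕ; zero; suc)
open import Data.Nat.ListAction using (sum)
import Data.Nat.Properties as ℕ
open import Data.Product using (∃; ∃-syntax; _×_; _,_; proj₁; proj₂)
open import Data.Rational
  using (ℚ; 0ℚ; 1ℚ; _<_; _≤_; _+_; _*_; _-_; -_; 1/_; _/_; Positive; NonZero; positive; nonNegative)
open import Data.Rational.Properties
open import Data.Rational.Solver using (module +-*-Solver)
open import Data.Sum as Sum using (_⊎_; inj₁; inj₂)
open import Relation.Binary using (Rel; Symmetric; Irreflexive)
import Relation.Binary as B
open import Relation.Binary.PropositionalEquality
  using (_≡_; _≢_; refl; sym; trans; cong; subst; subst₂)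
open import Relation.Nullary using (¬_; Dec; yes; no; contradiction)
open import Relation.Nullary.Decidable using (_×-dec_; _⊎-dec_; _→-dec_; ¬?)
open import Relation.Unary using (Pred; Decidable)

------------------------------------------------------------------------
-- Real numbers, as two-sided (located) Dedekind cuts of ℚ

record ℝ : Set₁ where
  field
    lower upper     : Pred ℚ 0ℓ
    lower-inhabited : ∃ lower
    upper-inhabited : ∃ upper
    lower-closed    : ∀ {p q} → p < q → lower q → lower p
    upper-closed    : ∀ {p q} → p < q → upper p → upper q
    lower-open      : ∀ {p} → lower p → ∃[ q ] p < q × lower q
    upper-open      : ∀ {q} → upper q → ∃[ p ] p < q × upper p
    disjoint        : ∀ {q} → ¬ (lower q × upper q)
    located         : ∀ {p q} → p < q → lower p ⊎ upper q

open ℝ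

infix 4 _≤ᵣ_

_≤ᵣ_ : Rel ℝ 0ℓ
x ≤ᵣ y = ∀ {q} → lower x q → lower y q

private
  p<p+1 : ∀ p → p < p + 1ℚ
  p<p+1 p = subst (_< p + 1ℚ) (+-identityʳ p) (+-monoʳ-< p (positive⁻¹ 1ℚ))

  p-1<p : ∀ p → p - 1ℚ < p
  p-1<p p = subst (p - 1ℚ <_) (+-identityʳ p) (+-monoʳ-< p (negative⁻¹ (- 1ℚ)))

fromℚ : ℚ → ℝ
fromℚ r = record
  { lower           = _< r
  ; upper           = r <_
  ; lower-inhabited = _ , p-1<p r
  ; upper-inhabited = _ , p<p+1 r
  ; lower-closed    = <-trans
  ; upper-closed    = λ p<q r<p → <-trans r<p p<q
  ; lower-open      = λ p<r → let q , p<q , q<r = <-dense p<r in q , p<q , q<r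
  ; upper-open      = λ r<q → let p , r<p , p<q = <-dense r<q in p , p<q , r<p
  ; disjoint        = λ (q<r , r<q) → <-asym q<r r<q
  ; located         = λ {p} {q} → loc p q
  }
  where
  loc : ∀ p q → p < q → p < r ⊎ r < q
  loc p q p<q with p <? r
  ... | yes p<r = inj₁ p<r
  ... | no  p≮r = inj₂ (≤-<-trans (≮⇒≥ p≮r) p<q)

fromℤ : ℤ → ℚ
fromℤ i = i / 1

-- The difference r − x of a rational and a real.
infixl 6 _⊖_

_⊖_ : ℚ → ℝ → ℝ
r ⊖ x = record
  { lower           = λ q → upper x (r - q)
  ; upper           = λ q → lower x (r - q)
  ; lower-inhabited = let s , u = upper-inhabited x in r - s , back (upper x) u
  ; upper-inhabited = let s , l = lower-inhabited x in r - s , back (lower x) l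
  ; lower-closed    = λ p<q → upper-closed x (flip p<q)
  ; upper-closed    = λ p<q → lower-closed x (flip p<q)
  ; lower-open      = λ {p} u → let s , s<r-p , us = upper-open x u in
                        r - s , subst (_< r - s) (invol p) (flip s<r-p) , back (upper x) us
  ; upper-open      = λ {q} l → let s , r-q<s , ls = lower-open x l in
                        r - s , subst (r - s <_) (invol q) (flip r-q<s) , back (lower x) ls
  ; disjoint        = λ (u , l) → disjoint x (l , u)
  ; located         = λ p<q → Sum.swap (located x (flip p<q))
  }
  where
  invol : ∀ s → r - (r - s) ≡ s
  invol s = solve 2 (λ r s → r :- (r :- s) := s) refl r s
    where open +-*-Solver

  flip : ∀ {p q} → p < q → r - q < r - p
  flip p<q = +-monoʳ-< r (neg-antimono-< p<q)

  back : (P : Pred ℚ 0ℓ) → ∀ {s} → P s → P (r - (r - s))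
  back P {s} = subst P (sym (invol s))

-- The product c · x of a positive rational and a real.
infixl 7 _⊙_

_⊙_ : (c : ℚ) .{{_ : Positive c}} → ℝ → ℝ
c ⊙ x = record
  { lower           = λ q → lower x (1/c * q)
  ; upper           = λ q → upper x (1/c * q)
  ; lower-inhabited = let s , l = lower-inhabited x in c * s , back (lower x) l
  ; upper-inhabited = let s , u = upper-inhabited x in c * s , back (upper x) u
  ; lower-closed    = λ p<q → lower-closed x (mono p<q)
  ; upper-closed    = λ p<q → upper-closed x (mono p<q)
  ; lower-open      = λ {p} l → let s , p/c<s , ls = lower-open x l in
                        c * s , subst (_< c * s) (invol p) (*-monoʳ-<-pos c p/c<s) , back (lower x) ls
  ; upper-open      = λ {q} u → let s , s<q/c , us = upper-open x u in
                        c * s , subst (c * s <_) (invol q) (*-monoʳ-<-pos c s<q/c) , back (upper x) us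
  ; disjoint        = disjoint x
  ; located         = λ p<q → located x (mono p<q)
  }
  where
  instance
    c≢0 : NonZero c
    c≢0 = pos⇒nonZero c

  1/c : ℚ
  1/c = 1/ c

  instance
    1/c>0 : Positive 1/c
    1/c>0 = 1/pos⇒pos c

  mono : ∀ {p q} → p < q → 1/c * p < 1/c * q
  mono = *-monoʳ-<-pos 1/c

  invol : ∀ s → c * (1/c * s) ≡ s
  invol s = trans (sym (*-assoc c 1/c s)) (trans (cong (_* s) (*-inverseʳ c)) (*-identityˡ s))

  invol′ : ∀ s → 1/c * (c * s) ≡ s
  invol′ s = trans (sym (*-assoc 1/c c s)) (trans (cong (_* s) (*-inverseˡ c)) (*-identityˡ s))

  back : (P : Pred ℚ 0ℓ) → ∀ {s} → P s → P (1/c * (c * s))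
  back P {s} = subst P (sym (invol′ s))

private module Sqrt (n : ℕ) where

  N C K : ℚ
  N = fromℤ (+ n)
  C = N + 1ℚ
  K = N * N + N + 1ℚ

  0≤N : 0ℚ ≤ N
  0≤N = nonNegative⁻¹ N {{normalize-nonNeg n 1}}

  0<1 : 0ℚ < 1ℚ
  0<1 = positive⁻¹ 1ℚ

  0≤N² : 0ℚ ≤ N * N
  0≤N² = subst (_≤ N * N) (*-zeroʳ N) (*-monoˡ-≤-nonNeg N {{nonNegative 0≤N}} 0≤N)

  0<C : 0ℚ < C
  0<C = +-mono-≤-< 0≤N 0<1

  0<K : 0ℚ < K
  0<K = +-mono-≤-< (+-mono-≤ 0≤N² 0≤N) 0<1

  Lower Upper : Pred ℚ 0ℓ
  Lower q = q < 0ℚ ⊎ q * q < N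
  Upper q = 0ℚ < q × N < q * q

  sq-mono-< : ∀ {p q} → 0ℚ ≤ p → p < q → p * p < q * q
  sq-mono-< {p} {q} 0≤p p<q = ≤-<-trans
    (*-monoˡ-≤-nonNeg p {{nonNegative 0≤p}} (<⇒≤ p<q))
    (*-monoˡ-<-pos q {{positive (≤-<-trans 0≤p p<q)}} p<q)

  -- For q ≥ 0 the rational q′ = (C q + N) / (q + C) lies strictly between q and √N
  -- (unless q² = N), because  (C q + N)² − N (q + C)² = K (q² − N).
  module Step (q : ℚ) (0≤q : 0ℚ ≤ q) where
    d y q′ : ℚ
    d = q + C

    0<d : 0ℚ < d
    0<d = +-mono-≤-< 0≤q 0<C

    instance
      d>0 : Positive d
      d>0 = positive 0<d
      d≢0 : NonZero d
      d≢0 = pos⇒nonZero d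

    y = 1/ d

    instance
      y>0 : Positive y
      y>0 = 1/pos⇒pos d

    t : ℚ
    t = C * q + N
    q′ = t * y

    dy : d * y ≡ 1ℚ
    dy = *-inverseʳ d

    shift : ∀ p → (p * d) * y ≡ p
    shift p = trans (*-assoc p d y) (trans (cong (p *_) dy) (*-identityʳ p))

    q² : q * d ≡ C * q + q * q
    q² = solve 2 (λ q c → q :* (q :+ c) := c :* q :+ q :* q) refl q C
      where open +-*-Solver

    up : q * q < N → q < q′
    up h = subst (_< q′) (shift q)
      (*-monoˡ-<-pos y (subst (_< t) (sym q²) (+-monoʳ-< (C * q) h)))

    down : N < q * q → q′ < q
    down h = subst (q′ <_) (shift q)
      (*-monoˡ-<-pos y (subst (t <_) (sym q²) (+-monoʳ-< (C * q) h)))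

    t² : t * t ≡ N * (d * d) + (K * (q * q) - K * N)
    t² = solve 2 (λ q n → let c = n :+ con 1ℚ ; k = n :* n :+ n :+ con 1ℚ ; t = c :* q :+ n in
           t :* t := n :* ((q :+ c) :* (q :+ c)) :+ (k :* (q :* q) :- k :* n)) refl q N
      where open +-*-Solver

    cancel : N * (d * d) ≡ N * (d * d) + (K * N - K * N)
    cancel = solve 2 (λ a b → a := a :+ (b :- b)) refl (N * (d * d)) (K * N)
      where open +-*-Solver

    q′² : (t * t) * y * y ≡ q′ * q′
    q′² = solve 2 (λ t y → (t :* t) :* y :* y := (t :* y) :* (t :* y)) refl t y
      where open +-*-Solver

    N≡ : N * (d * d) * y * y ≡ N
    N≡ = trans (solve 3 (λ n d y → n :* (d :* d) :* y :* y := (((n :* d) :* y) :* d) :* y) refl N d y)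
               (trans (shift _) (shift N))
      where open +-*-Solver

    up² : q * q < N → q′ * q′ < N
    up² h = subst₂ _<_ q′² N≡ (*-monoˡ-<-pos y (*-monoˡ-<-pos y
      (subst₂ _<_ (sym t²) (sym cancel)
        (+-monoʳ-< (N * (d * d)) (+-monoˡ-< (- (K * N)) (*-monoʳ-<-pos K {{positive 0<K}} h))))))

    down² : N < q * q → N < q′ * q′
    down² h = subst₂ _<_ N≡ q′² (*-monoˡ-<-pos y (*-monoˡ-<-pos y
      (subst₂ _<_ (sym cancel) (sym t²)
        (+-monoʳ-< (N * (d * d)) (+-monoˡ-< (- (K * N)) (*-monoʳ-<-pos K {{positive 0<K}} h))))))

    0<q′ : 0ℚ < q → 0ℚ < q′
    0<q′ 0<q = subst (_< q′) (*-zeroˡ y) (*-monoˡ-<-pos y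
      (+-mono-<-≤ (subst (_< C * q) (*-zeroʳ C) (*-monoʳ-<-pos C {{positive 0<C}} 0<q)) 0≤N))

  closedˡ : ∀ {p q} → p < q → Lower q → Lower p
  closedˡ p<q (inj₁ q<0) = inj₁ (<-trans p<q q<0)
  closedˡ {p} p<q (inj₂ q²<N) with p <? 0ℚ
  ... | yes p<0 = inj₁ p<0
  ... | no  p≮0 = inj₂ (<-trans (sq-mono-< (≮⇒≥ p≮0) p<q) q²<N)

  closedʳ : ∀ {p q} → p < q → Upper p → Upper q
  closedʳ p<q (0<p , N<p²) = <-trans 0<p p<q , <-trans N<p² (sq-mono-< (<⇒≤ 0<p) p<q)

  neg-open : ∀ {p} → p < 0ℚ → ∃[ q ] p < q × Lower q
  neg-open p<0 = let q , p<q , q<0 = <-dense p<0 in q , p<q , inj₁ q<0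

  openˡ : ∀ {p} → Lower p → ∃[ q ] p < q × Lower q
  openˡ (inj₁ p<0) = neg-open p<0
  openˡ {p} (inj₂ p²<N) with p <? 0ℚ
  ... | yes p<0 = neg-open p<0
  ... | no  p≮0 = q′ , up p²<N , inj₂ (up² p²<N)
    where open Step p (≮⇒≥ p≮0)

  openʳ : ∀ {q} → Upper q → ∃[ p ] p < q × Upper p
  openʳ {q} (0<q , N<q²) = q′ , down N<q² , 0<q′ 0<q , down² N<q²
    where open Step q (<⇒≤ 0<q)

  disj : ∀ {q} → ¬ (Lower q × Upper q)
  disj (inj₁ q<0  , 0<q , _)    = <-asym q<0 0<q
  disj (inj₂ q²<N , _   , N<q²) = <-asym q²<N N<q²

  loc : ∀ {p q} → p < q → Lower p ⊎ Upper q
  loc {p} {q} p<q with p <? 0ℚ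
  ... | yes p<0 = inj₁ (inj₁ p<0)
  ... | no  p≮0 with p * p <? N
  ...   | yes p²<N = inj₁ (inj₂ p²<N)
  ...   | no  p²≮N = inj₂ ( ≤-<-trans (≮⇒≥ p≮0) p<q
                          , ≤-<-trans (≮⇒≥ p²≮N) (sq-mono-< (≮⇒≥ p≮0) p<q))

  N<C² : N < C * C
  N<C² = subst₂ _<_ (+-identityˡ N)
    (solve 1 (λ n → (n :* n :+ n :+ con 1ℚ) :+ n := (n :+ con 1ℚ) :* (n :+ con 1ℚ)) refl N)
    (+-monoˡ-< N 0<K)
    where open +-*-Solver

√ : ℕ → ℝ
√ n = record
  { lower           = λ q → q < 0ℚ ⊎ q * q < fromℤ (+ n)
  ; upper           = λ q → 0ℚ < q × fromℤ (+ n) < q * q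
  ; lower-inhabited = - 1ℚ , inj₁ (negative⁻¹ (- 1ℚ))
  ; upper-inhabited = C , 0<C , N<C²
  ; lower-closed    = closedˡ
  ; upper-closed    = closedʳ
  ; lower-open      = openˡ
  ; upper-open      = openʳ
  ; disjoint        = disj
  ; located         = loc
  }
  where open Sqrt n

------------------------------------------------------------------------
-- Maxima of decidable predicates on ℕ

IsGreatest : Pred ℕ 0ℓ → ℕ → Set
IsGreatest P k = P k × (∀ {j} → P j → j ℕ.≤ k)

greatest : ∀ {P : Pred ℕ 0ℓ} → Decidable P → P 0 →
           ∀ b → (∀ {j} → P j → j ℕ.≤ b) → ∃ (IsGreatest P)
greatest P? P0 zero    bound = 0 , P0 , bound
greatest {P} P? P0 (suc b) bound with P? (suc b)
... | yes Pb = suc b , Pb , bound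
... | no ¬Pb = greatest P? P0 b λ Pj → ℕ.≤-pred (ℕ.≤∧≢⇒< (bound Pj) λ { refl → ¬Pb Pj })

------------------------------------------------------------------------
-- Finite simple graphs

record Graph : Set₁ where
  infix 4 _~_ _~?_
  field
    order  : ℕ
    _~_    : Rel (Fin order) 0ℓ
    _~?_   : B.Decidable _~_
    symm   : Symmetric _~_
    irrefl : Irreflexive _≡_ _~_

module _ (G : Graph) where
  open Graph G

  Vertex : Set
  Vertex = Fin order

  -- Each edge is listed once, as the pair (u , v) with u < v.
  edges : List (Vertex × Vertex)
  edges = filter (λ (u , v) → (u Fin.<? v) ×-dec (u ~? v))
                 (cartesianProduct (allFin order) (allFin order))

  m : ℕ
  m = length edges

  degree : Vertex → ℕ
  degree v = length (filter (v ~?_) (allFin order))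

  degreeSequence : List ℕ
  degreeSequence = sort ℕ.≤-decTotalOrder (map degree (allFin order))

  Independent : Pred (Subset order) 0ℓ
  Independent S = ∀ u → u ∈ S → ∀ v → v ∈ S → ¬ (u ~ v)

  Bipartite : Set
  Bipartite = ∃[ A ] Independent A × Independent (∁ A)

  Incident : Vertex → Fin m → Set
  Incident v e = v ≡ proj₁ (lookup edges e) ⊎ v ≡ proj₂ (lookup edges e)

  -- Sets of edges are subsets of the positions in the list of edges.
  Matching : Pred (Subset m) 0ℓ
  Matching M = ∀ e → e ∈ M → ∀ f → f ∈ M → e ≢ f → ∀ v → ¬ (Incident v e × Incident v f)

  independent? : Decidable Independent
  independent? S = Fin.all? λ u → (u ∈? S) →-dec Fin.all? λ v → (v ∈? S) →-dec ¬? (u ~? v)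

  matching? : Decidable Matching
  matching? M = Fin.all? λ e → (e ∈? M) →-dec Fin.all? λ f → (f ∈? M) →-dec
    ¬? (e Fin.≟ f) →-dec Fin.all? λ v → ¬? (incident? v e ×-dec incident? v f)
    where
    incident? : ∀ v e → Dec (Incident v e)
    incident? v e = (v Fin.≟ _) ⊎-dec (v Fin.≟ _)

  HasIndependentSet HasMatching Annihilates : Pred ℕ 0ℓ
  HasIndependentSet k = ∃[ S ] Independent S × ∣ S ∣ ≡ k
  HasMatching       k = ∃[ M ] Matching M × ∣ M ∣ ≡ k
  Annihilates       k = k ℕ.≤ order × sum (take k degreeSequence) ℕ.≤ m

  greatestIndependent : ∃ (IsGreatest HasIndependentSet)
  greatestIndependent = greatest
    (λ k → anySubset? λ S → independent? S ×-dec (∣ S ∣ ℕ.≟ k))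
    (⊥ , (λ _ u∈⊥ → contradiction u∈⊥ ∉⊥) , ∣⊥∣≡0 order)
    order λ { (S , _ , refl) → ∣p∣≤n S }

  greatestMatching : ∃ (IsGreatest HasMatching)
  greatestMatching = greatest
    (λ k → anySubset? λ M → matching? M ×-dec (∣ M ∣ ℕ.≟ k))
    (⊥ , (λ _ e∈⊥ → contradiction e∈⊥ ∉⊥) , ∣⊥∣≡0 m)
    m λ { (M , _ , refl) → ∣p∣≤n M }

  greatestAnnihilating : ∃ (IsGreatest Annihilates)
  greatestAnnihilating = greatest
    (λ k → (k ℕ.≤? order) ×-dec (sum (take k degreeSequence) ℕ.≤? m))
    (ℕ.z≤n , ℕ.z≤n)
    order proj₁

  independenceNumber matchingNumber annihilationNumber : ℕ
  independenceNumber = proj₁ greatestIndependent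
  matchingNumber     = proj₁ greatestMatching
  annihilationNumber = proj₁ greatestAnnihilating

{-# OPTIONS --safe #-}
module Submission where

-- Let h = n − a.  The a vertices of smallest degree have degree sum at most m, so they span at
-- most as many edges as the other h vertices, that is at most h²/4 as the graph is bipartite.
-- The h vertices and one end of each edge missed by them form a vertex cover, whence
-- n − α ≤ h + h²/4.  By König's theorem n − α ≤ μ, so that s = 2 + μ + α − a satisfies s ≥ 2 + h
-- and s² ≥ 4 (1 + μ).
--
-- König's theorem is obtained by deleting edges as long as the cover number stays at least t:
-- if neither of two adjacent edges can be deleted, then exchanging two small covers across the
-- bipartition gives a cover of the whole graph that is too small (Lovász).

open import Defs
open import Data.Bool using (true; false; if_then_else_)
open import Data.Fin as Fin using (Fin; zero; suc)
import Data.Fin.Properties as Fin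
open import Data.Fin.Subset
  using (Subset; inside; outside; _∈_; _∉_; ∣_∣; _∩_; _∪_; ∁; ⁅_⁆; ⊥; ⊤)
  renaming (_-_ to _∖_)
open import Data.Fin.Subset.Properties
import Data.Integer as ℤ
import Data.Integer.Properties as ℤ
open import Data.Integer.Solver using () renaming (module +-*-Solver to ℤ-Solver)
open import Data.List
  using (List; []; _∷_; _++_; filter; length; lookup; map; allFin; cartesianProduct; take; drop)
open import Data.List.Membership.DecPropositional using () renaming (_∈?_ to mem?)
open import Data.List.Membership.Propositional using () renaming (_∈_ to _∈ₗ_)
open import Data.List.Membership.Propositional.Properties
  using (∈-allFin; ∈-cartesianProduct⁺; ∈-filter⁺; ∈-filter⁻; ∈-lookup; ∈-++⁺ˡ; ∈-++⁺ʳ; ∈-map⁺)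
open import Data.List.Properties
  using (map-cong; map-++; map-∘; map-tabulate; length-++; length-drop; length-map; length-tabulate;
         take-map; take++drop≡id)
open import Data.List.Relation.Binary.Permutation.Propositional using (_↭_; ↭-sym)
open import Data.List.Relation.Binary.Permutation.Propositional.Properties
  using (map⁺; ↭-length; ↭-map-inv)
open import Data.List.Relation.Unary.Any using (here; there; index)
open import Data.List.Relation.Unary.Any.Properties using (lookup-index)
open import Data.Nat using (ℕ; zero; suc; _+_; _*_; _∸_; _≤_; _<_; z≤n; s≤s)
open import Data.Nat.Induction using (<-rec)
open import Data.Nat.ListAction using (sum)
open import Data.Nat.ListAction.Properties using (sum-++; sum-↭)
import Data.Nat.Properties as ℕ
open import Data.Nat.Tactic.RingSolver using (solve-∀)
open import Data.List.Sort ℕ.≤-decTotalOrder using (sort-↭)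
open import Data.Product using (∃₂; ∃-syntax; _×_; _,_; proj₁; proj₂)
open import Data.Rational as ℚ using (ℚ; 0ℚ)
import Data.Rational.Properties as ℚ
open import Data.Rational.Solver using (module +-*-Solver)
import Data.Rational.Unnormalised as ℚᵘ
import Data.Rational.Unnormalised.Properties as ℚᵘ
open import Data.Sum as Sum using (_⊎_; inj₁; inj₂)
open import Data.Vec using ([]; _∷_; here; there)
open import Function using (_∘_)
open import Relation.Binary.Definitions using (tri<; tri≈; tri>)
open import Relation.Binary.PropositionalEquality
open import Relation.Nullary using (¬_; Dec; yes; no; does; contradiction)
open import Relation.Nullary.Decidable
  using (_×-dec_; _⊎-dec_; _→-dec_; ¬?; dec-true; dec-false)
open import Relation.Unary using (Pred; Decidable)

-- König's theorem

∣p∪q∣≤∣p∣+∣q∣ : ∀ {n} (p q : Subset n) → ∣ p ∪ q ∣ ≤ ∣ p ∣ + ∣ q ∣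
∣p∪q∣≤∣p∣+∣q∣ []            []            = z≤n
∣p∪q∣≤∣p∣+∣q∣ (outside ∷ p) (outside ∷ q) = ∣p∪q∣≤∣p∣+∣q∣ p q
∣p∪q∣≤∣p∣+∣q∣ (outside ∷ p) (inside ∷ q)  =
  ℕ.≤-trans (s≤s (∣p∪q∣≤∣p∣+∣q∣ p q)) (ℕ.≤-reflexive (sym (ℕ.+-suc ∣ p ∣ ∣ q ∣)))
∣p∪q∣≤∣p∣+∣q∣ (inside ∷ p)  (outside ∷ q) = s≤s (∣p∪q∣≤∣p∣+∣q∣ p q)
∣p∪q∣≤∣p∣+∣q∣ (inside ∷ p)  (inside ∷ q)  =
  s≤s (ℕ.≤-trans (∣p∪q∣≤∣p∣+∣q∣ p q) (ℕ.+-monoʳ-≤ ∣ p ∣ (ℕ.n≤1+n ∣ q ∣)))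

-- Covers arise as ends of edges or as lists, both of which may repeat vertices; an upper bound on
-- the size is all that is wanted of the resulting subset.
image : ∀ {k n} (f : Fin k → Fin n) (E : Subset k) →
        ∃[ W ] (∀ e → e ∈ E → f e ∈ W) × ∣ W ∣ ≤ ∣ E ∣
image {n = n} f [] = ⊥ , (λ ()) , ℕ.≤-reflexive (∣⊥∣≡0 n)
image f (outside ∷ E) =
  let W , f∈W , ∣W∣≤∣E∣ = image (f ∘ suc) E
  in  W , (λ { (suc e) (there e∈E) → f∈W e e∈E }) , ∣W∣≤∣E∣
image f (inside ∷ E) =
  let W , f∈W , ∣W∣≤∣E∣ = image (f ∘ suc) E
  in  ⁅ f zero ⁆ ∪ W
    , (λ { zero    here        → x∈p∪q⁺ (inj₁ (x∈⁅x⁆ (f zero)))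
         ; (suc e) (there e∈E) → x∈p∪q⁺ (inj₂ (f∈W e e∈E)) })
    , ℕ.≤-trans (∣p∪q∣≤∣p∣+∣q∣ ⁅ f zero ⁆ W)
        (ℕ.+-mono-≤ (ℕ.≤-reflexive (∣⁅x⁆∣≡1 (f zero))) ∣W∣≤∣E∣)

-- Vertex covers of a bipartite graph with class `A` form a lattice: this is its meet, and the same
-- formula along `∁ A` is its join.
exchange : ∀ {n} → Subset n → Subset n → Subset n → Subset n
exchange A p q = (A ∩ (p ∩ q)) ∪ (∁ A ∩ (p ∪ q))

-- At each position one of the two exchanges takes the intersection and the other the union, which
-- together count the same as `p` and `q`.
∣exchange∣ : ∀ {n} (A p q : Subset n) →
             ∣ exchange A p q ∣ + ∣ exchange (∁ A) p q ∣ ≡ ∣ p ∣ + ∣ q ∣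
∣exchange∣ []            []            []            = refl
∣exchange∣ (inside ∷ A)  (inside ∷ p)  (inside ∷ q)  =
  cong suc (trans (ℕ.+-suc _ _) (trans (cong suc (∣exchange∣ A p q)) (sym (ℕ.+-suc ∣ p ∣ ∣ q ∣))))
∣exchange∣ (inside ∷ A)  (inside ∷ p)  (outside ∷ q) = trans (ℕ.+-suc _ _) (cong suc (∣exchange∣ A p q))
∣exchange∣ (inside ∷ A)  (outside ∷ p) (inside ∷ q)  =
  trans (ℕ.+-suc _ _) (trans (cong suc (∣exchange∣ A p q)) (sym (ℕ.+-suc ∣ p ∣ ∣ q ∣)))
∣exchange∣ (inside ∷ A)  (outside ∷ p) (outside ∷ q) = ∣exchange∣ A p q
∣exchange∣ (outside ∷ A) (inside ∷ p)  (inside ∷ q)  =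
  cong suc (trans (ℕ.+-suc _ _) (trans (cong suc (∣exchange∣ A p q)) (sym (ℕ.+-suc ∣ p ∣ ∣ q ∣))))
∣exchange∣ (outside ∷ A) (inside ∷ p)  (outside ∷ q) = cong suc (∣exchange∣ A p q)
∣exchange∣ (outside ∷ A) (outside ∷ p) (inside ∷ q)  =
  trans (cong suc (∣exchange∣ A p q)) (sym (ℕ.+-suc ∣ p ∣ ∣ q ∣))
∣exchange∣ (outside ∷ A) (outside ∷ p) (outside ∷ q) = ∣exchange∣ A p q

module _ {n} {A p q : Subset n} where

  ∈-exchange-out : ∀ {y} → y ∉ A → y ∈ p ⊎ y ∈ q → y ∈ exchange A p q
  ∈-exchange-out y∉A y∈ = x∈p∪q⁺ (inj₂ (x∈p∩q⁺ (x∉p⇒x∈∁p y∉A , x∈p∪q⁺ y∈)))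

  -- The end outside `A` needs only one of `p`, `q` to contain it; if neither does, both contain the
  -- end inside `A`.
  exchange-covers : ∀ {x y} → x ∈ A → y ∉ A → x ∈ p ⊎ y ∈ p → x ∈ q ⊎ y ∈ q →
                    x ∈ exchange A p q ⊎ y ∈ exchange A p q
  exchange-covers x∈A y∉A (inj₂ y∈p) _          = inj₂ (∈-exchange-out y∉A (inj₁ y∈p))
  exchange-covers x∈A y∉A (inj₁ x∈p) (inj₂ y∈q) = inj₂ (∈-exchange-out y∉A (inj₂ y∈q))
  exchange-covers x∈A y∉A (inj₁ x∈p) (inj₁ x∈q) =
    inj₁ (x∈p∪q⁺ (inj₁ (x∈p∩q⁺ (x∈A , x∈p∩q⁺ (x∈p , x∈q)))))

-- Edges are indexed by Fin k, and edge e joins x e and y e.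

Covers : ∀ {k n} → (x y : Fin k → Fin n) → Subset k → Subset n → Set
Covers x y E W = ∀ e → e ∈ E → x e ∈ W ⊎ y e ∈ W

CoverNumber≥ : ∀ {k n} → (x y : Fin k → Fin n) → Subset k → ℕ → Set
CoverNumber≥ x y E t = ∀ W → Covers x y E W → t ≤ ∣ W ∣

module _ {k n} (x y : Fin k → Fin n) where

  -- There are finitely many subsets to search, so a failing bound yields an explicit small cover
  -- without excluded middle.
  coverNumber≥⊎cover : ∀ E t → CoverNumber≥ x y E t ⊎ (∃[ W ] Covers x y E W × ∣ W ∣ < t)
  coverNumber≥⊎cover E t with anySubset? (λ W →
      Fin.all? (λ e → (e ∈? E) →-dec ((x e ∈? W) ⊎-dec (y e ∈? W))) ×-dec (∣ W ∣ ℕ.<? t))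
  ... | yes cover = inj₂ cover
  ... | no ¬cover = inj₁ λ W covers → ℕ.≮⇒≥ λ ∣W∣<t → ¬cover (W , covers , ∣W∣<t)

  covers-extend : ∀ {E W} e → Covers x y (E ∖ e) W → x e ∈ W ⊎ y e ∈ W → Covers x y E W
  covers-extend e covers e-covered g g∈E with g Fin.≟ e
  ... | yes refl = e-covered
  ... | no g≢e   = covers g (x∈p∧x≢y⇒x∈p-y g∈E g≢e)

  -- Given covers V of E ∖ e and W of E ∖ f smaller than t, the exchange along A covers E and
  -- the exchange along ∁ A covers E once the shared end is added, but together they have
  -- |V| + |W| elements.
  deletable : ∀ {A E t e f} → (∀ e → x e ∈ A) → (∀ e → y e ∉ A) →
              e ∈ E → f ∈ E → e ≢ f → x e ≡ x f → CoverNumber≥ x y E t →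
              ∃[ g ] g ∈ E × CoverNumber≥ x y (E ∖ g) t
  deletable {A} {E} {t} {e} {f} x∈A y∉A e∈E f∈E e≢f xe≡xf τ≥t
    with coverNumber≥⊎cover (E ∖ e) t | coverNumber≥⊎cover (E ∖ f) t
  ... | inj₁ τ≥t′ | _         = e , e∈E , τ≥t′
  ... | inj₂ _    | inj₁ τ≥t′ = f , f∈E , τ≥t′
  ... | inj₂ (V , V-covers , ∣V∣<t) | inj₂ (W , W-covers , ∣W∣<t) =
    contradiction counting (ℕ.<⇒≱ ℕ.≤-refl)
    where
    -- Otherwise `V` would cover `e` as well, hence all of `E`, with fewer than `t` vertices.
    xe∉V : x e ∉ V
    xe∉V xe∈V = ℕ.<⇒≱ ∣V∣<t (τ≥t V (covers-extend e V-covers (inj₁ xe∈V)))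

    xf∉W : x f ∉ W
    xf∉W xf∈W = ℕ.<⇒≱ ∣W∣<t (τ≥t W (covers-extend f W-covers (inj₁ xf∈W)))

    -- The edge `e` survives the deletion of `f`, so `W` covers it, but not at the shared end.
    ye∈W : y e ∈ W
    ye∈W with W-covers e (x∈p∧x≢y⇒x∈p-y e∈E e≢f)
    ... | inj₁ xe∈W = contradiction (subst (_∈ W) xe≡xf xe∈W) xf∉W
    ... | inj₂ ye∈W = ye∈W

    yf∈V : y f ∈ V
    yf∈V with V-covers f (x∈p∧x≢y⇒x∈p-y f∈E (e≢f ∘ sym))
    ... | inj₁ xf∈V = contradiction (subst (_∈ V) (sym xe≡xf) xf∈V) xe∉V
    ... | inj₂ yf∈V = yf∈V

    V⊓W V⊔W : Subset n
    V⊓W = exchange A V W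
    V⊔W = exchange (∁ A) V W

    ⊓-covers : Covers x y E V⊓W
    ⊓-covers g g∈E with g Fin.≟ e | g Fin.≟ f
    ... | yes refl | _        = inj₂ (∈-exchange-out (y∉A e) (inj₂ ye∈W))
    ... | no _     | yes refl = inj₂ (∈-exchange-out (y∉A f) (inj₁ yf∈V))
    ... | no g≢e   | no g≢f   = exchange-covers (x∈A g) (y∉A g)
      (V-covers g (x∈p∧x≢y⇒x∈p-y g∈E g≢e)) (W-covers g (x∈p∧x≢y⇒x∈p-y g∈E g≢f))

    ⊔-covers : Covers x y E (⁅ x e ⁆ ∪ V⊔W)
    ⊔-covers g g∈E with g Fin.≟ e | g Fin.≟ f
    ... | yes refl | _        = inj₁ (x∈p∪q⁺ (inj₁ (x∈⁅x⁆ (x e))))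
    ... | no _     | yes refl = inj₁ (x∈p∪q⁺ (inj₁ (subst (_∈ ⁅ x e ⁆) xe≡xf (x∈⁅x⁆ (x e)))))
    -- Along `∁ A` the two ends of an edge trade roles, hence the swaps.
    ... | no g≢e   | no g≢f   = Sum.map (x∈p∪q⁺ ∘ inj₂) (x∈p∪q⁺ ∘ inj₂) (Sum.swap
      (exchange-covers (x∉p⇒x∈∁p (y∉A g)) (x∈p⇒x∉∁p (x∈A g))
        (Sum.swap (V-covers g (x∈p∧x≢y⇒x∈p-y g∈E g≢e)))
        (Sum.swap (W-covers g (x∈p∧x≢y⇒x∈p-y g∈E g≢f)))))

    -- The strict bounds on `V` and `W` put 2t at least two above their total size; the two covers
    -- of `E` put it at most one above.
    counting : suc (suc (∣ V ∣ + ∣ W ∣)) ≤ suc (∣ V ∣ + ∣ W ∣)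
    counting = begin
      suc (suc (∣ V ∣ + ∣ W ∣))       ≡⟨ cong suc (ℕ.+-suc ∣ V ∣ ∣ W ∣) ⟨
      suc ∣ V ∣ + suc ∣ W ∣           ≤⟨ ℕ.+-mono-≤ ∣V∣<t ∣W∣<t ⟩
      t + t                           ≤⟨ ℕ.+-mono-≤ (τ≥t _ ⊓-covers) (τ≥t _ ⊔-covers) ⟩
      ∣ V⊓W ∣ + ∣ ⁅ x e ⁆ ∪ V⊔W ∣     ≤⟨ ℕ.+-monoʳ-≤ ∣ V⊓W ∣ (∣p∪q∣≤∣p∣+∣q∣ ⁅ x e ⁆ V⊔W) ⟩
      ∣ V⊓W ∣ + (∣ ⁅ x e ⁆ ∣ + ∣ V⊔W ∣) ≡⟨ cong (λ s → ∣ V⊓W ∣ + (s + ∣ V⊔W ∣)) (∣⁅x⁆∣≡1 (x e)) ⟩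
      ∣ V⊓W ∣ + suc ∣ V⊔W ∣           ≡⟨ ℕ.+-suc ∣ V⊓W ∣ ∣ V⊔W ∣ ⟩
      suc (∣ V⊓W ∣ + ∣ V⊔W ∣)         ≡⟨ cong suc (∣exchange∣ A V W) ⟩
      suc (∣ V ∣ + ∣ W ∣)             ∎
      where open ℕ.≤-Reasoning

coverNumber≥-swap : ∀ {k n} {x y : Fin k → Fin n} {E t} →
                    CoverNumber≥ x y E t → CoverNumber≥ y x E t
coverNumber≥-swap τ≥t W covers = τ≥t W λ e e∈E → Sum.swap (covers e e∈E)

-- Meant for `x` and `y` with values on opposite sides of a bipartition: mixed ends then never meet,
-- so this describes a matching.
Disjoint : ∀ {k n} → (x y : Fin k → Fin n) → Subset k → Set
Disjoint x y M = ∀ e → e ∈ M → ∀ f → f ∈ M → e ≢ f → x e ≢ x f × y e ≢ y f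

module _ {k n} {A : Subset n} {x y : Fin k → Fin n}
         (x∈A : ∀ e → x e ∈ A) (y∉A : ∀ e → y e ∉ A) where

  disjoint⊎deletable : ∀ {t} E → CoverNumber≥ x y E t →
                       Disjoint x y E ⊎ (∃[ g ] g ∈ E × CoverNumber≥ x y (E ∖ g) t)
  disjoint⊎deletable E τ≥t
    with Fin.any? (λ e → Fin.any? λ f → (e ∈? E) ×-dec (f ∈? E) ×-dec ¬? (e Fin.≟ f)
           ×-dec ((x e Fin.≟ x f) ⊎-dec (y e Fin.≟ y f)))
  ... | yes (e , f , e∈E , f∈E , e≢f , inj₁ xe≡xf) =
    inj₂ (deletable x y x∈A y∉A e∈E f∈E e≢f xe≡xf τ≥t)
  -- The mirror image: the two kinds of ends are swapped and `A` becomes `∁ A`.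
  ... | yes (e , f , e∈E , f∈E , e≢f , inj₂ ye≡yf) =
    let g , g∈E , τ≥t′ = deletable y x {∁ A} (x∉p⇒x∈∁p ∘ y∉A) (x∈p⇒x∉∁p ∘ x∈A)
                           e∈E f∈E e≢f ye≡yf (coverNumber≥-swap τ≥t)
    in  inj₂ (g , g∈E , coverNumber≥-swap τ≥t′)
  ... | no ¬adjacent = inj₁ λ e e∈E f f∈E e≢f →
      (λ eq → ¬adjacent (e , f , e∈E , f∈E , e≢f , inj₁ eq))
    , (λ eq → ¬adjacent (e , f , e∈E , f∈E , e≢f , inj₂ eq))

  -- Deletions that keep the bound `t` must stop, by induction on the number of edges. The remaining
  -- edges are disjoint and are covered by their `x`-ends, one per edge, so there are at least `t`
  -- of them.
  könig : ∀ {t} E → CoverNumber≥ x y E t → ∃[ M ] Disjoint x y M × t ≤ ∣ M ∣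
  könig {t} E = <-rec P step ∣ E ∣ E refl
    where
    P : ℕ → Set
    P s = ∀ E → ∣ E ∣ ≡ s → CoverNumber≥ x y E t → ∃[ M ] Disjoint x y M × t ≤ ∣ M ∣

    step : ∀ s → (∀ {r} → r < s → P r) → P s
    step _ rec E refl τ≥t with disjoint⊎deletable E τ≥t
    ... | inj₂ (g , g∈E , τ≥t′) = rec (x∈p⇒∣p-x∣<∣p∣ g∈E) (E ∖ g) refl τ≥t′
    ... | inj₁ disjoint =
      let W , x∈W , ∣W∣≤∣E∣ = image x E
      in  E , disjoint , ℕ.≤-trans (τ≥t W λ e e∈E → inj₁ (x∈W e e∈E)) ∣W∣≤∣E∣

-- Sums over lists

-- The Iverson bracket, by which counting becomes summation.
⟦_⟧ : ∀ {P : Set} → Dec P → ℕ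
⟦ P? ⟧ = if does P? then 1 else 0

⟦⟧-true : ∀ {P : Set} (P? : Dec P) → P → ⟦ P? ⟧ ≡ 1
⟦⟧-true P? p = cong (if_then 1 else 0) (dec-true P? p)

⟦⟧-false : ∀ {P : Set} (P? : Dec P) → ¬ P → ⟦ P? ⟧ ≡ 0
⟦⟧-false P? ¬p = cong (if_then 1 else 0) (dec-false P? ¬p)

⟦⟧≤1 : ∀ {P : Set} (P? : Dec P) → ⟦ P? ⟧ ≤ 1
⟦⟧≤1 P? with does P?
... | true  = s≤s z≤n
... | false = z≤n

∑ : ∀ {A : Set} → List A → (A → ℕ) → ℕ
∑ xs f = sum (map f xs)

infixr 6.5 ∑
syntax ∑ xs (λ x → e) = ∑[ x ← xs ] e

module _ {A : Set} where

  ∑-cong : ∀ xs {f g : A → ℕ} → (∀ x → f x ≡ g x) → ∑ xs f ≡ ∑ xs g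
  ∑-cong xs f≗g = cong sum (map-cong f≗g xs)

  ∑-mono : ∀ xs {f g : A → ℕ} → (∀ {x} → x ∈ₗ xs → f x ≤ g x) → ∑ xs f ≤ ∑ xs g
  ∑-mono []       f≤g = z≤n
  ∑-mono (x ∷ xs) f≤g = ℕ.+-mono-≤ (f≤g (here refl)) (∑-mono xs (f≤g ∘ there))

  ∑-0 : ∀ (xs : List A) → ∑[ _ ← xs ] 0 ≡ 0
  ∑-0 []       = refl
  ∑-0 (x ∷ xs) = ∑-0 xs

  ∑-1 : ∀ (xs : List A) → ∑[ _ ← xs ] 1 ≡ length xs
  ∑-1 []       = refl
  ∑-1 (x ∷ xs) = cong suc (∑-1 xs)

  ∑-++ : ∀ xs ys (f : A → ℕ) → ∑ (xs ++ ys) f ≡ ∑ xs f + ∑ ys f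
  ∑-++ xs ys f = trans (cong sum (map-++ f xs ys)) (sum-++ (map f xs) (map f ys))

  ∑-↭ : ∀ {xs ys} (f : A → ℕ) → xs ↭ ys → ∑ xs f ≡ ∑ ys f
  ∑-↭ f xs↭ys = sum-↭ (map⁺ f xs↭ys)

  ∑-+ : ∀ xs (f g : A → ℕ) → ∑[ x ← xs ] (f x + g x) ≡ ∑ xs f + ∑ xs g
  ∑-+ []       f g = refl
  ∑-+ (x ∷ xs) f g = trans (cong (f x + g x +_) (∑-+ xs f g))
                           (solve (f x) (g x) (∑ xs f) (∑ xs g))
    where
    solve : ∀ a b c d → (a + b) + (c + d) ≡ (a + c) + (b + d)
    solve = solve-∀

  ∑-*ʳ : ∀ xs (f : A → ℕ) c → ∑[ x ← xs ] f x * c ≡ ∑ xs f * c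
  ∑-*ʳ []       f c = refl
  ∑-*ʳ (x ∷ xs) f c = trans (cong (f x * c +_) (∑-*ʳ xs f c)) (sym (ℕ.*-distribʳ-+ c (f x) (∑ xs f)))

  ∑-*ˡ : ∀ xs (f : A → ℕ) c → ∑[ x ← xs ] c * f x ≡ c * ∑ xs f
  ∑-*ˡ xs f c = trans (∑-cong xs λ x → ℕ.*-comm c (f x)) (trans (∑-*ʳ xs f c) (ℕ.*-comm _ c))

  ∑-filter : ∀ {P : Pred A _} (P? : Decidable P) xs (f : A → ℕ) →
             ∑ (filter P? xs) f ≡ ∑[ x ← xs ] ⟦ P? x ⟧ * f x
  ∑-filter P? []       f = refl
  ∑-filter P? (x ∷ xs) f with does (P? x)
  ... | true  = cong₂ _+_ (sym (ℕ.*-identityˡ (f x))) (∑-filter P? xs f)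
  ... | false = ∑-filter P? xs f

  length-filter-∑ : ∀ {P : Pred A _} (P? : Decidable P) xs →
                    length (filter P? xs) ≡ ∑[ x ← xs ] ⟦ P? x ⟧
  length-filter-∑ P? xs = trans (sym (∑-1 (filter P? xs)))
    (trans (∑-filter P? xs _) (∑-cong xs λ x → ℕ.*-identityʳ ⟦ P? x ⟧))

module _ {A B : Set} where

  ∑-swap : ∀ (xs : List A) (ys : List B) (f : A → B → ℕ) →
           ∑[ x ← xs ] ∑[ y ← ys ] f x y ≡ ∑[ y ← ys ] ∑[ x ← xs ] f x y
  ∑-swap []       ys f = sym (∑-0 ys)
  ∑-swap (x ∷ xs) ys f = trans (cong (∑ ys (f x) +_) (∑-swap xs ys f)) (sym (∑-+ ys (f x) _))

  ∑-cartesianProduct : ∀ (xs : List A) (ys : List B) (f : A × B → ℕ) →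
                       ∑ (cartesianProduct xs ys) f ≡ ∑[ x ← xs ] ∑[ y ← ys ] f (x , y)
  ∑-cartesianProduct []       ys f = refl
  ∑-cartesianProduct (x ∷ xs) ys f =
    trans (∑-++ (map (x ,_) ys) (cartesianProduct xs ys) f)
      (cong₂ _+_ (cong sum (sym (map-∘ ys))) (∑-cartesianProduct xs ys f))

∑-allFin-suc : ∀ {n} (f : Fin (suc n) → ℕ) → ∑ (allFin (suc n)) f ≡ f zero + ∑ (allFin n) (f ∘ suc)
∑-allFin-suc {n} f = cong (λ ys → f zero + sum ys)
  (trans (map-tabulate suc f) (sym (map-tabulate (λ i → i) (f ∘ suc))))

∑-δ : ∀ {n} x (g : Fin n → ℕ) → ∑[ i ← allFin n ] ⟦ i Fin.≟ x ⟧ * g i ≡ g x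
∑-δ {suc n} zero g = trans (∑-allFin-suc {n} _)
  (trans (cong₂ _+_ (ℕ.*-identityˡ (g zero)) (∑-0 (allFin n))) (ℕ.+-identityʳ (g zero)))
∑-δ {suc n} (suc x) g =
  trans (∑-allFin-suc {n} λ i → ⟦ i Fin.≟ suc x ⟧ * g i) (∑-δ x (g ∘ suc))

-- Turns a list of vertices into a weight on all vertices, so that sums over part of the degree
-- sequence become weighted sums over the whole graph.
multiplicity : ∀ {n} → List (Fin n) → Fin n → ℕ
multiplicity xs i = ∑[ x ← xs ] ⟦ i Fin.≟ x ⟧

∑-multiplicity : ∀ {n} xs (g : Fin n → ℕ) → ∑[ i ← allFin n ] multiplicity xs i * g i ≡ ∑ xs g
∑-multiplicity {n} xs g = begin
  ∑[ i ← allFin n ] multiplicity xs i * g i             ≡⟨ ∑-cong (allFin n) (λ i → ∑-*ʳ xs _ (g i)) ⟨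
  ∑[ i ← allFin n ] ∑[ x ← xs ] ⟦ i Fin.≟ x ⟧ * g i     ≡⟨ ∑-swap (allFin n) xs _ ⟩
  ∑[ x ← xs ] ∑[ i ← allFin n ] ⟦ i Fin.≟ x ⟧ * g i     ≡⟨ ∑-cong xs (λ x → ∑-δ x g) ⟩
  ∑ xs g                                               ∎
  where open ≡-Reasoning

multiplicity-allFin : ∀ {n} (i : Fin n) → multiplicity (allFin n) i ≡ 1
multiplicity-allFin {n} i = trans (∑-cong (allFin n) flip) (∑-δ i (λ _ → 1))
  where
  -- `∑-δ` tests the equality in the opposite direction and carries a factor.
  flip : ∀ x → ⟦ i Fin.≟ x ⟧ ≡ ⟦ x Fin.≟ i ⟧ * 1
  flip x with x Fin.≟ i
  ... | yes refl = ⟦⟧-true (i Fin.≟ i) refl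
  ... | no x≢i   = ⟦⟧-false (i Fin.≟ x) (x≢i ∘ sym)

multiplicity-∉ : ∀ {n} {i : Fin n} xs → ¬ (i ∈ₗ xs) → multiplicity xs i ≡ 0
multiplicity-∉ []       i∉xs = refl
multiplicity-∉ {i = i} (x ∷ xs) i∉xs =
  cong₂ _+_ (⟦⟧-false (i Fin.≟ x) (i∉xs ∘ here)) (multiplicity-∉ xs (i∉xs ∘ there))

-- The inequality of arithmetic and geometric means, without subtraction: raising both numbers by
-- one adds 4 (m + n + 1) to either side.
4mn≤[m+n]² : ∀ m n → 4 * (m * n) ≤ (m + n) * (m + n)
4mn≤[m+n]² zero    n       = z≤n
4mn≤[m+n]² (suc m) zero    = ℕ.≤-trans (ℕ.≤-reflexive (cong (4 *_) (ℕ.*-zeroʳ m))) z≤n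
4mn≤[m+n]² (suc m) (suc n) = begin
  4 * (suc m * suc n)                    ≡⟨ lhs m n ⟩
  4 * (m * n) + 4 * suc (m + n)          ≤⟨ ℕ.+-monoˡ-≤ _ (4mn≤[m+n]² m n) ⟩
  (m + n) * (m + n) + 4 * suc (m + n)    ≡⟨ rhs m n ⟨
  (suc m + suc n) * (suc m + suc n)      ∎
  where
  open ℕ.≤-Reasoning
  lhs : ∀ m n → 4 * (suc m * suc n) ≡ 4 * (m * n) + 4 * suc (m + n)
  lhs = solve-∀
  rhs : ∀ m n → (suc m + suc n) * (suc m + suc n) ≡ (m + n) * (m + n) + 4 * suc (m + n)
  rhs = solve-∀

-- Counting edges and covers

module _ (G : Graph) where
  open Graph G

  private
    n = order
    V = allFin order

  ∑edges : (Vertex G → Vertex G → ℕ) → ℕ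
  ∑edges f = ∑[ e ← edges G ] f (proj₁ e) (proj₂ e)

  ∈-edges⁻ : ∀ {u v} → (u , v) ∈ₗ edges G → u ~ v
  ∈-edges⁻ uv∈ = proj₂ (proj₂ (∈-filter⁻ (λ (u , v) → (u Fin.<? v) ×-dec (u ~? v))
                                      {xs = cartesianProduct V V} uv∈))

  ∈-edges⁺ : ∀ {u v} → u ~ v → (u , v) ∈ₗ edges G ⊎ (v , u) ∈ₗ edges G
  ∈-edges⁺ {u} {v} u~v with Fin.<-cmp u v
  ... | tri< u<v _ _ = inj₁ (∈-filter⁺ _ (∈-cartesianProduct⁺ (∈-allFin u) (∈-allFin v)) (u<v , u~v))
  ... | tri≈ _ u≡v _ = contradiction u~v (irrefl u≡v)
  ... | tri> _ _ v<u = inj₂ (∈-filter⁺ _ (∈-cartesianProduct⁺ (∈-allFin v) (∈-allFin u)) (v<u , symm u~v))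

  -- An edge is listed in one order only, so adding both values of `F` visits each ordered adjacent
  -- pair exactly once.
  ∑edges-both-orders : ∀ (F : Vertex G → Vertex G → ℕ) →
                       ∑edges (λ u v → F u v + F v u) ≡ ∑[ u ← V ] ∑[ v ← V ] ⟦ u ~? v ⟧ * F u v
  ∑edges-both-orders F = begin
    ∑edges (λ u v → F u v + F v u)
      ≡⟨ ∑-filter _ (cartesianProduct V V) _ ⟩
    ∑[ e ← cartesianProduct V V ] χ (proj₁ e) (proj₂ e) * (F (proj₁ e) (proj₂ e) + F (proj₂ e) (proj₁ e))
      ≡⟨ ∑-cartesianProduct V V _ ⟩
    ∑[ u ← V ] ∑[ v ← V ] χ u v * (F u v + F v u)
      ≡⟨ ∑-cong V (λ u → trans (∑-cong V λ v → ℕ.*-distribˡ-+ (χ u v) (F u v) (F v u)) (∑-+ V _ _)) ⟩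
    ∑[ u ← V ] ((∑[ v ← V ] χ u v * F u v) + (∑[ v ← V ] χ u v * F v u))
      ≡⟨ ∑-+ V _ _ ⟩
    (∑[ u ← V ] ∑[ v ← V ] χ u v * F u v) + (∑[ u ← V ] ∑[ v ← V ] χ u v * F v u)
      -- Exchanging the summations and renaming moves the reversal from `F` to `χ`.
      ≡⟨ cong ((∑[ u ← V ] ∑[ v ← V ] χ u v * F u v) +_) (∑-swap V V _) ⟩
    (∑[ u ← V ] ∑[ v ← V ] χ u v * F u v) + (∑[ u ← V ] ∑[ v ← V ] χ v u * F u v)
      ≡⟨ ∑-+ V _ _ ⟨
    ∑[ u ← V ] ((∑[ v ← V ] χ u v * F u v) + (∑[ v ← V ] χ v u * F u v))
      ≡⟨ ∑-cong V (λ u → trans (sym (∑-+ V _ _)) (∑-cong V λ v →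
           trans (sym (ℕ.*-distribʳ-+ (F u v) (χ u v) (χ v u))) (cong (_* F u v) (χ-sym u v)))) ⟩
    ∑[ u ← V ] ∑[ v ← V ] ⟦ u ~? v ⟧ * F u v ∎
    where
    open ≡-Reasoning
    χ : Vertex G → Vertex G → ℕ
    χ u v = ⟦ (u Fin.<? v) ×-dec (u ~? v) ⟧

    χ-sym : ∀ u v → χ u v + χ v u ≡ ⟦ u ~? v ⟧
    χ-sym u v with u ~? v
    ... | no ¬u~v = cong₂ _+_ (⟦⟧-false ((u Fin.<? v) ×-dec no ¬u~v) (¬u~v ∘ proj₂))
                              (⟦⟧-false ((v Fin.<? u) ×-dec (v ~? u)) (¬u~v ∘ symm ∘ proj₂))
    ... | yes u~v with Fin.<-cmp u v
    ...   | tri< u<v _ v≮u = cong₂ _+_ (⟦⟧-true ((u Fin.<? v) ×-dec yes u~v) (u<v , u~v))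
                                       (⟦⟧-false ((v Fin.<? u) ×-dec (v ~? u)) (v≮u ∘ proj₁))
    ...   | tri≈ _ u≡v _   = contradiction u~v (irrefl u≡v)
    ...   | tri> u≮v _ v<u = cong₂ _+_ (⟦⟧-false ((u Fin.<? v) ×-dec yes u~v) (u≮v ∘ proj₁))
                                       (⟦⟧-true ((v Fin.<? u) ×-dec (v ~? u)) (v<u , symm u~v))

  -- The handshake lemma with weights; an indicator as weight relates a partial degree sum to the
  -- ends of edges in that set.
  handshake : ∀ (g : Vertex G → ℕ) → ∑edges (λ u v → g u + g v) ≡ ∑[ u ← V ] g u * degree G u
  handshake g = trans (∑edges-both-orders λ u _ → g u) (∑-cong V λ u →
    trans (∑-*ʳ V _ (g u)) (trans (ℕ.*-comm _ (g u))
      (cong (g u *_) (sym (length-filter-∑ (u ~?_) V)))))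

  -- Vertex covers and the independence number

  IsVertexCover : Subset n → Set
  IsVertexCover W = ∀ {u v} → u ~ v → u ∈ W ⊎ v ∈ W

  -- The complement of a vertex cover is independent.
  order≤α+cover : ∀ {W} → IsVertexCover W → order ≤ independenceNumber G + ∣ W ∣
  order≤α+cover {W} covers = begin
    order                                ≤⟨ ℕ.m≤n+m∸n order ∣ W ∣ ⟩
    ∣ W ∣ + (order ∸ ∣ W ∣)              ≡⟨ cong (∣ W ∣ +_) (∣∁p∣≡n∸∣p∣ W) ⟨
    ∣ W ∣ + ∣ ∁ W ∣                      ≤⟨ ℕ.+-monoʳ-≤ ∣ W ∣ (proj₂ (proj₂ (greatestIndependent G))
                                              (∁ W , independent , refl)) ⟩
    ∣ W ∣ + independenceNumber G         ≡⟨ ℕ.+-comm ∣ W ∣ _ ⟩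
    independenceNumber G + ∣ W ∣         ∎
    where
    open ℕ.≤-Reasoning
    independent : Independent G (∁ W)
    independent u u∈ v v∈ u~v = Sum.[ x∈∁p⇒x∉p u∈ , x∈∁p⇒x∉p v∈ ]′ (covers u~v)

  -- For covers built by concatenation: repetitions in the list only help, and each edge is checked
  -- just in its listed order.
  order≤α+list : ∀ xs → (∀ {u v} → (u , v) ∈ₗ edges G → u ∈ₗ xs ⊎ v ∈ₗ xs) →
                 order ≤ independenceNumber G + length xs
  order≤α+list xs covers =
    let W , xs⊆W , ∣W∣≤∣⊤∣ = image (lookup xs) ⊤
        ∈W : ∀ {w} → w ∈ₗ xs → w ∈ W
        ∈W w∈xs = subst (_∈ W) (sym (lookup-index w∈xs)) (xs⊆W (index w∈xs) ∈⊤)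
        covers′ : IsVertexCover W
        covers′ u~v = Sum.[ Sum.map ∈W ∈W ∘ covers , Sum.swap ∘ Sum.map ∈W ∈W ∘ covers ]′ (∈-edges⁺ u~v)
    in  ℕ.≤-trans (order≤α+cover covers′)
          (ℕ.+-monoʳ-≤ _ (ℕ.≤-trans ∣W∣≤∣⊤∣ (ℕ.≤-reflexive (∣⊤∣≡n (length xs)))))

  -- König's theorem for a bipartite graph

  module _ {A : Subset n} (A-ind : Independent G A) (∁A-ind : Independent G (∁ A)) where

    ~⇒∉ : ∀ {u v} → u ~ v → u ∈ A → v ∉ A
    ~⇒∉ u~v u∈A v∈A = A-ind _ u∈A _ v∈A u~v

    ~⇒∈ : ∀ {u v} → u ~ v → u ∉ A → v ∈ A
    ~⇒∈ {u} {v} u~v u∉A with v ∈? A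
    ... | yes v∈A = v∈A
    ... | no v∉A  = contradiction u~v (∁A-ind _ (x∉p⇒x∈∁p u∉A) _ (x∉p⇒x∈∁p v∉A))

    private
      -- Edges are listed by the order of the vertices, whereas `könig` wants the end in `A` first;
      -- the last component remembers whether the pair was turned.
      orient : ∀ e → ∃₂ λ x y → x ∈ A × y ∉ A ×
               (lookup (edges G) e ≡ (x , y) ⊎ lookup (edges G) e ≡ (y , x))
      orient e with lookup (edges G) e | ∈-lookup {xs = edges G} e
      ... | u , v | uv∈ with u ∈? A
      ...   | yes u∈A = u , v , u∈A , ~⇒∉ (∈-edges⁻ uv∈) u∈A , inj₁ refl
      ...   | no  u∉A = v , u , ~⇒∈ (∈-edges⁻ uv∈) u∉A , u∉A , inj₂ refl

      x y : Fin (m G) → Vertex G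
      x e = proj₁ (orient e)
      y e = proj₁ (proj₂ (orient e))

      x∈A : ∀ e → x e ∈ A
      x∈A e = proj₁ (proj₂ (proj₂ (orient e)))

      y∉A : ∀ e → y e ∉ A
      y∉A e = proj₁ (proj₂ (proj₂ (proj₂ (orient e))))

      ends : ∀ e → lookup (edges G) e ≡ (x e , y e) ⊎ lookup (edges G) e ≡ (y e , x e)
      ends e = proj₂ (proj₂ (proj₂ (proj₂ (orient e))))

      incident : ∀ {v e} → Incident G v e → v ≡ x e ⊎ v ≡ y e
      incident {v} {e} = go (ends e)
        where
        go : ∀ {p} → p ≡ (x e , y e) ⊎ p ≡ (y e , x e) → v ≡ proj₁ p ⊎ v ≡ proj₂ p → v ≡ x e ⊎ v ≡ y e
        go (inj₁ refl) = λ i → i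
        go (inj₂ refl) = Sum.swap

      disjoint⇒matching : ∀ {M} → Disjoint x y M → Matching G M
      disjoint⇒matching disjoint e e∈M f f∈M e≢f v (v-e , v-f)
        with disjoint e e∈M f f∈M e≢f | incident {e = e} v-e | incident {e = f} v-f
      ... | xe≢xf , _ | inj₁ refl | inj₁ eq   = xe≢xf eq
      ... | _ , ye≢yf | inj₂ refl | inj₂ eq   = ye≢yf eq
      -- A vertex that is an `x`-end of one edge and a `y`-end of the other would lie both in `A`
      -- and outside it.
      ... | _         | inj₁ refl | inj₂ eq   = y∉A f (subst (_∈ A) eq (x∈A e))
      ... | _         | inj₂ refl | inj₁ eq   = y∉A e (subst (_∈ A) (sym eq) (x∈A f))

      covers⇒cover : ∀ {W} → Covers x y ⊤ W → IsVertexCover W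
      covers⇒cover {W} covers u~v = Sum.[ edge , Sum.swap ∘ edge ]′ (∈-edges⁺ u~v)
        where
        edge : ∀ {u v} → (u , v) ∈ₗ edges G → u ∈ W ⊎ v ∈ W
        edge uv∈ = go (lookup-index uv∈) (ends e) (covers e ∈⊤)
          where
          e = index uv∈
          go : ∀ {p u v} → (u , v) ≡ p → p ≡ (x e , y e) ⊎ p ≡ (y e , x e) →
               x e ∈ W ⊎ y e ∈ W → u ∈ W ⊎ v ∈ W
          go refl (inj₁ refl) = λ c → c
          go refl (inj₂ refl) = Sum.swap

    -- Every vertex cover has at least n - α elements, so König's theorem supplies a matching of
    -- that size.
    order≤α+μ : order ≤ independenceNumber G + matchingNumber G
    order≤α+μ =
      let α = independenceNumber G
          M , disjoint , n∸α≤∣M∣ = könig x∈A y∉A {order ∸ α} ⊤ λ W covers →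
            ℕ.m≤n+o⇒m∸n≤o order α (order≤α+cover (covers⇒cover covers))
      in  ℕ.≤-trans (ℕ.m≤n+m∸n order α) (ℕ.+-monoʳ-≤ α (ℕ.≤-trans n∸α≤∣M∣
            (proj₂ (proj₂ (greatestMatching G)) (M , disjoint⇒matching disjoint , refl))))

  -- The degree sequence sorts numbers; pulling the permutation back through `degree` recovers
  -- vertices that carry them.
  degreeSequence-list : ∃[ vs ] degreeSequence G ≡ map (degree G) vs × V ↭ vs
  degreeSequence-list = ↭-map-inv (degree G) (↭-sym (sort-↭ (map (degree G) V)))

  -- Splitting the vertices into low and high degree

  module Split (a : ℕ) (annihilates : Annihilates G a) where

    private
      vs = proj₁ degreeSequence-list

    low high : List (Vertex G)
    low  = take a vs
    high = drop a vs

    -- Since vs lists every vertex once, these are the indicators of a set and its complement.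
    ℓ η : Vertex G → ℕ
    ℓ = multiplicity low
    η = multiplicity high

    ℓ+η≡1 : ∀ v → ℓ v + η v ≡ 1
    ℓ+η≡1 v = begin
      ℓ v + η v                      ≡⟨ ∑-++ low high _ ⟨
      multiplicity (low ++ high) v   ≡⟨ cong (λ ws → multiplicity ws v) (take++drop≡id a vs) ⟩
      multiplicity vs v              ≡⟨ ∑-↭ _ (proj₂ (proj₂ degreeSequence-list)) ⟨
      multiplicity V v               ≡⟨ multiplicity-allFin v ⟩
      1                              ∎
      where open ≡-Reasoning

    length-high : length high ≡ order ∸ a
    length-high = trans (length-drop a vs) (cong (_∸ a)
      (trans (sym (↭-length (proj₂ (proj₂ degreeSequence-list)))) (length-tabulate _)))

    ∑-low-degree≤m : ∑[ v ← V ] ℓ v * degree G v ≤ m G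
    ∑-low-degree≤m = begin
      ∑[ v ← V ] ℓ v * degree G v          ≡⟨ ∑-multiplicity low (degree G) ⟩
      ∑ low (degree G)                     ≡⟨ cong sum (take-map a vs) ⟨
      sum (take a (map (degree G) vs))     ≡⟨ cong (sum ∘ take a) (proj₁ (proj₂ degreeSequence-list)) ⟨
      sum (take a (degreeSequence G))      ≤⟨ proj₂ annihilates ⟩
      m G                                  ∎
      where open ℕ.≤-Reasoning

    lowEdges highEdges : ℕ
    lowEdges  = ∑edges λ u v → ℓ u * ℓ v
    highEdges = ∑edges λ u v → η u * η v

    -- For each edge, 1 + [both ends low] = number of low ends + [both ends high]. Summed over the
    -- edges, the low ends contribute the low degree sum, which is at most m.
    lowEdges≤highEdges : lowEdges ≤ highEdges
    lowEdges≤highEdges = ℕ.+-cancelˡ-≤ (m G) _ _ (begin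
      m G + lowEdges                                 ≡⟨ cong (_+ lowEdges) (∑-1 (edges G)) ⟨
      ∑edges (λ _ _ → 1) + lowEdges                  ≡⟨ ∑-+ (edges G) _ _ ⟨
      ∑edges (λ u v → 1 + ℓ u * ℓ v)                 ≡⟨ ∑-cong (edges G) (λ (u , v) →
                                                          count {ℓ u} {ℓ v} (ℓ+η≡1 u) (ℓ+η≡1 v)) ⟩
      ∑edges (λ u v → (ℓ u + ℓ v) + η u * η v)       ≡⟨ ∑-+ (edges G) _ _ ⟩
      ∑edges (λ u v → ℓ u + ℓ v) + highEdges         ≡⟨ cong (_+ highEdges) (handshake ℓ) ⟩
      (∑[ v ← V ] ℓ v * degree G v) + highEdges      ≤⟨ ℕ.+-monoˡ-≤ highEdges ∑-low-degree≤m ⟩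
      m G + highEdges                                ∎)
      where
      open ℕ.≤-Reasoning
      count : ∀ {a b c d} → a + c ≡ 1 → b + d ≡ 1 → 1 + a * b ≡ (a + b) + c * d
      count {zero}        {zero}        refl refl = refl
      count {zero}        {suc zero}    refl refl = refl
      count {suc zero}    {zero}        refl refl = refl
      count {suc zero}    {suc zero}    refl refl = refl

    -- The cover consists of `high` and the first end of every edge that `high` misses; such an edge
    -- has both ends low.
    order≤α+high+lowEdges : order ≤ independenceNumber G + (length high + lowEdges)
    order≤α+high+lowEdges = begin
      order                                                   ≤⟨ order≤α+list xs covers ⟩
      independenceNumber G + length xs                        ≡⟨ cong (independenceNumber G +_) length-xs ⟩
      independenceNumber G + (length high + length uncovered) ≤⟨ ℕ.+-monoʳ-≤ (independenceNumber G)
                                                                   (ℕ.+-monoʳ-≤ (length high) few) ⟩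
      independenceNumber G + (length high + lowEdges)         ∎
      where
      open ℕ.≤-Reasoning
      _∈high? : ∀ v → Dec (v ∈ₗ high)
      v ∈high? = mem? Fin._≟_ v high

      uncovered? : ∀ (e : Vertex G × Vertex G) → Dec (¬ (proj₁ e ∈ₗ high) × ¬ (proj₂ e ∈ₗ high))
      uncovered? (u , v) = ¬? (u ∈high?) ×-dec ¬? (v ∈high?)

      uncovered : List (Vertex G × Vertex G)
      uncovered = filter uncovered? (edges G)

      xs : List (Vertex G)
      xs = high ++ map proj₁ uncovered

      length-xs : length xs ≡ length high + length uncovered
      length-xs = trans (length-++ high) (cong (length high +_) (length-map proj₁ uncovered))

      covers : ∀ {u v} → (u , v) ∈ₗ edges G → u ∈ₗ xs ⊎ v ∈ₗ xs
      covers {u} {v} uv∈ with u ∈high? | v ∈high?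
      ... | yes u∈ | _      = inj₁ (∈-++⁺ˡ u∈)
      ... | no _   | yes v∈ = inj₂ (∈-++⁺ˡ v∈)
      ... | no u∉  | no v∉  = inj₁ (∈-++⁺ʳ high (∈-map⁺ proj₁ (∈-filter⁺ uncovered? uv∈ (u∉ , v∉))))

      ∉high⇒ℓ≡1 : ∀ {v} → ¬ (v ∈ₗ high) → ℓ v ≡ 1
      ∉high⇒ℓ≡1 {v} v∉ = trans (sym (ℕ.+-identityʳ (ℓ v)))
        (trans (cong (ℓ v +_) (sym (multiplicity-∉ high v∉))) (ℓ+η≡1 v))

      few : length uncovered ≤ lowEdges
      few = ℕ.≤-trans (ℕ.≤-reflexive (length-filter-∑ uncovered? (edges G)))
        (∑-mono (edges G) λ {e} _ → bound e)
        where
        bound : ∀ e → ⟦ uncovered? e ⟧ ≤ ℓ (proj₁ e) * ℓ (proj₂ e)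
        bound (u , v) with u ∈high? | v ∈high?
        ... | yes _ | _     = z≤n
        ... | no _  | yes _ = z≤n
        ... | no u∉ | no v∉ = ℕ.≤-reflexive (sym (cong₂ _*_ (∉high⇒ℓ≡1 u∉) (∉high⇒ℓ≡1 v∉)))

    module _ {A : Subset n} (A-ind : Independent G A) (∁A-ind : Independent G (∁ A)) where

      private
        P Q : Vertex G → ℕ
        P v = η v * ⟦ v ∈? A ⟧
        Q v = η v * ⟦ ¬? (v ∈? A) ⟧

        P+Q≡η : ∀ v → P v + Q v ≡ η v * 1
        P+Q≡η v = trans (sym (ℕ.*-distribˡ-+ (η v) ⟦ v ∈? A ⟧ ⟦ ¬? (v ∈? A) ⟧)) (cong (η v *_) total)
          where
          total : ⟦ v ∈? A ⟧ + ⟦ ¬? (v ∈? A) ⟧ ≡ 1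
          total with v ∈? A
          ... | yes _ = refl
          ... | no _  = refl

        ∑P+∑Q : ∑ V P + ∑ V Q ≡ length high
        ∑P+∑Q = begin
          ∑ V P + ∑ V Q            ≡⟨ ∑-+ V P Q ⟨
          ∑[ v ← V ] (P v + Q v)   ≡⟨ ∑-cong V P+Q≡η ⟩
          ∑[ v ← V ] η v * 1       ≡⟨ ∑-multiplicity high (λ _ → 1) ⟩
          ∑[ _ ← high ] 1          ≡⟨ ∑-1 high ⟩
          length high              ∎
          where open ≡-Reasoning

        -- Two products appear because the listing does not tell which end lies in `A`; exactly one
        -- of them accounts for the edge.
        bipartite-edge : ∀ {u v} → u ~ v → η u * η v ≤ P u * Q v + P v * Q u
        bipartite-edge {u} {v} u~v with u ∈? A | v ∈? A
        ... | yes u∈A | yes v∈A = contradiction u~v (A-ind u u∈A v v∈A)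
        ... | no u∉A  | no v∉A  = contradiction u~v (∁A-ind u (x∉p⇒x∈∁p u∉A) v (x∉p⇒x∈∁p v∉A))
        ... | yes _   | no _    = ℕ.≤-trans (ℕ.≤-reflexive (lemma (η u) (η v))) (ℕ.m≤m+n _ _)
          where
          lemma : ∀ a b → a * b ≡ a * 1 * (b * 1)
          lemma = solve-∀
        ... | no _    | yes _   = ℕ.≤-trans (ℕ.≤-reflexive (lemma (η u) (η v))) (ℕ.m≤n+m _ _)
          where
          lemma : ∀ a b → a * b ≡ b * 1 * (a * 1)
          lemma = solve-∀

      -- Edges among the high vertices run between their two sides, so they are no more than the
      -- product of the sizes of these sides.
      4*highEdges≤high² : 4 * highEdges ≤ length high * length high
      4*highEdges≤high² = begin
        4 * highEdges
          ≤⟨ ℕ.*-monoʳ-≤ 4 (∑-mono (edges G) (bipartite-edge ∘ ∈-edges⁻)) ⟩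
        4 * ∑edges (λ u v → P u * Q v + P v * Q u)
          ≡⟨ cong (4 *_) (∑edges-both-orders λ u v → P u * Q v) ⟩
        4 * (∑[ u ← V ] ∑[ v ← V ] ⟦ u ~? v ⟧ * (P u * Q v))
          -- Adjacency is forgotten here, as if the two sides were completely joined.
          ≤⟨ ℕ.*-monoʳ-≤ 4 (∑-mono V λ {u} _ → ∑-mono V λ {v} _ →
               ℕ.≤-trans (ℕ.*-monoˡ-≤ (P u * Q v) (⟦⟧≤1 (u ~? v))) (ℕ.≤-reflexive (ℕ.*-identityˡ _))) ⟩
        4 * (∑[ u ← V ] ∑[ v ← V ] P u * Q v)
          ≡⟨ cong (4 *_) (trans (∑-cong V λ u → ∑-*ˡ V Q (P u)) (∑-*ʳ V P (∑ V Q))) ⟩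
        4 * (∑ V P * ∑ V Q)
          ≤⟨ 4mn≤[m+n]² (∑ V P) (∑ V Q) ⟩
        (∑ V P + ∑ V Q) * (∑ V P + ∑ V Q)
          ≡⟨ cong₂ _*_ ∑P+∑Q ∑P+∑Q ⟩
        length high * length high ∎
        where open ℕ.≤-Reasoning

  -- With s = 2 + μ - (a - α) the goal reads 2√(1 + μ) ≤ s, which for s ≥ 0 is the squared
  -- inequality. The equation is additive to keep `s` in ℕ.
  bipartite-slack : Bipartite G →
    let a = annihilationNumber G ; α = independenceNumber G ; μ = matchingNumber G in
    ∃[ s ] α + (2 + μ) ≡ a + s × 4 * (1 + μ) ≤ s * s
  bipartite-slack (A , A-ind , ∁A-ind) =
    let h , a+h≡n = ℕ.m≤n⇒∃[o]m+o≡n (proj₁ annihilates)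
        d , n+d≡α+μ = ℕ.m≤n⇒∃[o]m+o≡n (order≤α+μ A-ind ∁A-ind)
        high≡h = trans length-high (trans (cong (_∸ a) (sym a+h≡n)) (ℕ.m+n∸m≡n a h))
    -- Here h = n - a, and d = α + μ - n is the slack in König's bound, so μ + α - a = h + d.
    in  2 + h + d
      , trans (lhs α μ) (trans (cong (_+ 2) (trans (sym n+d≡α+μ) (cong (_+ d) (sym a+h≡n)))) (rhs a h d))
      , bound h d (ℕ.+-cancelˡ-≤ α _ _ (begin
          α + μ                        ≡⟨ n+d≡α+μ ⟨
          order + d                    ≤⟨ ℕ.+-monoˡ-≤ d order≤α+high+lowEdges ⟩
          α + (length high + lowEdges) + d  ≡⟨ cong (λ l → α + (l + lowEdges) + d) high≡h ⟩
          α + (h + lowEdges) + d       ≡⟨ ℕ.+-assoc α (h + lowEdges) d ⟩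
          α + (h + lowEdges + d)       ∎))
        (ℕ.≤-trans (ℕ.*-monoʳ-≤ 4 lowEdges≤highEdges)
          (subst (λ l → 4 * highEdges ≤ l * l) high≡h (4*highEdges≤high² A-ind ∁A-ind)))
    where
    open ℕ.≤-Reasoning
    a = annihilationNumber G
    α = independenceNumber G
    μ = matchingNumber G
    annihilates = proj₁ (proj₂ (greatestAnnihilating G))
    open Split a annihilates

    lhs : ∀ α μ → α + (2 + μ) ≡ α + μ + 2
    lhs = solve-∀
    rhs : ∀ a h d → a + h + d + 2 ≡ a + (2 + h + d)
    rhs = solve-∀

    -- The square exceeds h² + 4 + 4h + 4d by 2hd + d².
    bound : ∀ h d {e μ} → μ ≤ h + e + d → 4 * e ≤ h * h → 4 * (1 + μ) ≤ (2 + h + d) * (2 + h + d)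
    bound h d {e} {μ} μ≤ 4e≤h² = begin
      4 * (1 + μ)                                      ≤⟨ ℕ.*-monoʳ-≤ 4 (s≤s μ≤) ⟩
      4 * (1 + (h + e + d))                            ≡⟨ expand h e d ⟩
      4 * e + (4 + 4 * h + 4 * d)                      ≤⟨ ℕ.+-monoˡ-≤ _ 4e≤h² ⟩
      h * h + (4 + 4 * h + 4 * d)                      ≤⟨ ℕ.m≤m+n _ (2 * h * d + d * d) ⟩
      h * h + (4 + 4 * h + 4 * d) + (2 * h * d + d * d) ≡⟨ square h d ⟩
      (2 + h + d) * (2 + h + d)                        ∎
      where
      expand : ∀ h e d → 4 * (1 + (h + e + d)) ≡ 4 * e + (4 + 4 * h + 4 * d)
      expand = solve-∀
      square : ∀ h d → h * h + (4 + 4 * h + 4 * d) + (2 * h * d + d * d) ≡ (2 + h + d) * (2 + h + d)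
      square = solve-∀

-- The inequality over the reals

-- Opened only here, since with the prefix +_ in scope ∣ p ∣ + suc n does not parse uniquely.
open import Data.Integer using (+_; _-_)

-- The reduction to lowest terms inside `i / 1` is stuck for a variable `i`, so the identity is
-- checked on unnormalised fractions.
fromℤ-+ : ∀ i j → fromℤ (i ℤ.+ j) ≡ fromℤ i ℚ.+ fromℤ j
fromℤ-+ i j = ℚ.toℚᵘ-injective (begin
  ℚ.toℚᵘ (fromℤ (i ℤ.+ j))                ≈⟨ ℚ.toℚᵘ-fromℚᵘ (ℚᵘ.mkℚᵘ (i ℤ.+ j) 0) ⟩
  ℚᵘ.mkℚᵘ (i ℤ.+ j) 0                     ≡⟨ cong₂ (λ i j → ℚᵘ.mkℚᵘ (i ℤ.+ j) 0) (ℤ.*-identityʳ i) (ℤ.*-identityʳ j) ⟨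
  ℚᵘ.mkℚᵘ i 0 ℚᵘ.+ ℚᵘ.mkℚᵘ j 0            ≈⟨ ℚᵘ.+-cong (ℚ.toℚᵘ-fromℚᵘ (ℚᵘ.mkℚᵘ i 0)) (ℚ.toℚᵘ-fromℚᵘ (ℚᵘ.mkℚᵘ j 0)) ⟨
  ℚ.toℚᵘ (fromℤ i) ℚᵘ.+ ℚ.toℚᵘ (fromℤ j)  ≈⟨ ℚ.toℚᵘ-homo-+ (fromℤ i) (fromℤ j) ⟨
  ℚ.toℚᵘ (fromℤ i ℚ.+ fromℤ j)            ∎)
  where open ℚᵘ.≃-Reasoning

fromℤ-* : ∀ i j → fromℤ (i ℤ.* j) ≡ fromℤ i ℚ.* fromℤ j
fromℤ-* i j = ℚ.toℚᵘ-injective (begin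
  ℚ.toℚᵘ (fromℤ (i ℤ.* j))                ≈⟨ ℚ.toℚᵘ-fromℚᵘ (ℚᵘ.mkℚᵘ (i ℤ.* j) 0) ⟩
  ℚᵘ.mkℚᵘ i 0 ℚᵘ.* ℚᵘ.mkℚᵘ j 0            ≈⟨ ℚᵘ.*-cong (ℚ.toℚᵘ-fromℚᵘ (ℚᵘ.mkℚᵘ i 0)) (ℚ.toℚᵘ-fromℚᵘ (ℚᵘ.mkℚᵘ j 0)) ⟨
  ℚ.toℚᵘ (fromℤ i) ℚᵘ.* ℚ.toℚᵘ (fromℤ j)  ≈⟨ ℚ.toℚᵘ-homo-* (fromℤ i) (fromℤ j) ⟨
  ℚ.toℚᵘ (fromℤ i ℚ.* fromℤ j)            ∎)
  where open ℚᵘ.≃-Reasoning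

fromℤ-mono-≤ : ∀ {i j} → i ℤ.≤ j → fromℤ i ℚ.≤ fromℤ j
fromℤ-mono-≤ {i} {j} i≤j = ℚ.toℚᵘ-cancel-≤
  (ℚᵘ.≤-respˡ-≃ (ℚᵘ.≃-sym (ℚ.toℚᵘ-fromℚᵘ (ℚᵘ.mkℚᵘ i 0)))
    (ℚᵘ.≤-respʳ-≃ (ℚᵘ.≃-sym (ℚ.toℚᵘ-fromℚᵘ (ℚᵘ.mkℚᵘ j 0)))
      (ℚᵘ.*≤* (ℤ.*-monoʳ-≤-nonNeg (+ 1) i≤j))))

sq-mono-< : ∀ {p q} → 0ℚ ℚ.≤ p → p ℚ.< q → p ℚ.* p ℚ.< q ℚ.* q
sq-mono-< {p} {q} 0≤p p<q = ℚ.≤-<-trans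
  (ℚ.*-monoˡ-≤-nonNeg p {{ℚ.nonNegative 0≤p}} (ℚ.<⇒≤ p<q))
  (ℚ.*-monoˡ-<-pos q {{ℚ.positive (ℚ.≤-<-trans 0≤p p<q)}} p<q)

-- By the definitions of ⊖ and ⊙, what is claimed for each q < k is upper (√ c) ((b - q) / 2);
-- it holds because b - q > s.
≤-minus-2√ : ∀ {k b} s c → k ℤ.+ + s ≡ b → 4 * c ≤ s * s →
             fromℚ (fromℤ k) ≤ᵣ fromℤ b ⊖ fromℤ (+ 2) ⊙ √ c
≤-minus-2√ {k} {b} s c refl 4c≤s² {q} q<k = 0<r , c<r²
  where
  S t r : ℚ
  S = fromℤ (+ s)
  t = fromℤ b ℚ.- q
  r = (ℚ.1/ fromℤ (+ 2)) ℚ.* t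

  S<t : S ℚ.< t
  S<t = subst₂ ℚ._<_ (left S q) (trans (right (fromℤ k) S q) (cong (ℚ._- q) (sym (fromℤ-+ k (+ s)))))
          (ℚ.+-monoˡ-< (S ℚ.- q) q<k)
    where
    open +-*-Solver
    left : ∀ S q → q ℚ.+ (S ℚ.- q) ≡ S
    left = solve 2 (λ S q → q :+ (S :- q) := S) refl
    right : ∀ k S q → k ℚ.+ (S ℚ.- q) ≡ (k ℚ.+ S) ℚ.- q
    right = solve 3 (λ k S q → k :+ (S :- q) := (k :+ S) :- q) refl

  0≤S : 0ℚ ℚ.≤ S
  0≤S = fromℤ-mono-≤ {+ 0} {+ s} (ℤ.+≤+ z≤n)

  0<r : 0ℚ ℚ.< r
  0<r = ℚ.*-monoʳ-<-pos (ℚ.1/ fromℤ (+ 2)) (ℚ.≤-<-trans 0≤S S<t)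

  4r²≡t² : fromℤ (+ 4) ℚ.* (r ℚ.* r) ≡ t ℚ.* t
  4r²≡t² = solve 1 (λ t → let r = con (ℚ.1/ fromℤ (+ 2)) :* t in
    con (fromℤ (+ 4)) :* (r :* r) := t :* t) refl t
    where open +-*-Solver

  -- From 4c ≤ s² < t² = 4r² the factor 4 is cancelled; the strict part uses 0 ≤ s < t.
  c<r² : fromℤ (+ c) ℚ.< r ℚ.* r
  c<r² = ℚ.*-cancelˡ-<-nonNeg (fromℤ (+ 4)) (subst₂ ℚ._<_ refl (sym 4r²≡t²)
    (ℚ.≤-<-trans (subst₂ ℚ._≤_ (trans (cong fromℤ (ℤ.pos-* 4 c)) (fromℤ-* (+ 4) (+ c)))
                               (trans (cong fromℤ (ℤ.pos-* s s)) (fromℤ-* (+ s) (+ s)))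
                   (fromℤ-mono-≤ {+ (4 * c)} {+ (s * s)} (ℤ.+≤+ 4c≤s²)))
                 (sq-mono-< 0≤S S<t)))

theorem3p2 : (G : Graph) → Bipartite G →
  let a = annihilationNumber G
      α = independenceNumber G
      μ = matchingNumber G
  in fromℚ (fromℤ (+ a - + α)) ≤ᵣ fromℤ (+ (2 + μ)) ⊖ fromℤ (+ 2) ⊙ √ (1 + μ)
theorem3p2 G bipartite =
  let s , α+2+μ≡a+s , 4+4μ≤s² = bipartite-slack G bipartite
  in  ≤-minus-2√ {+ a - + α} s (1 + μ) (slack a α s (2 + μ) α+2+μ≡a+s) 4+4μ≤s²
  where
  a = annihilationNumber G
  α = independenceNumber G
  μ = matchingNumber G

  slack : ∀ a α s b → α + b ≡ a + s → (+ a - + α) ℤ.+ + s ≡ + b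
  slack a α s b α+b≡a+s = begin
    (+ a - + α) ℤ.+ + s          ≡⟨ solve 3 (λ a α s → (a :- α) :+ s := (a :+ s) :- α) refl (+ a) (+ α) (+ s) ⟩
    -- `+ a ℤ.+ + s` computes to `+ (a + s)`, so the equation over ℕ applies under `+_`.
    + (a + s) - + α              ≡⟨ cong (λ t → + t - + α) α+b≡a+s ⟨
    + (α + b) - + α              ≡⟨ solve 2 (λ α b → (α :+ b) :- α := b) refl (+ α) (+ b) ⟩
    + b                          ∎
    where
    open ≡-Reasoning
    open ℤ-Solver
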